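{- Let $\Omega$ be a set of orderings with at least seven elements, in which either at least half of the elements are initial or at least half of the elements are final. Then $\Omega$ is balanced.
   Context: Let $S$ be a finite set. A set of orderings $\Omega$ on $S$ is a nonempty set of total orderings (permutations) of $S$; the members of $S$ are its elements. For distinct elements $x,y$, $\Pr[x<y]$ denotes the probability that $x$ occurs earlier than $y$ in an ordering chosen uniformly at random from $\Omega$. A pair $x,y$ is a balanced pair if $\frac13\le \Pr[x<y]\le\frac23$; $\Omega$ is balanced if it contains a balanced pair or consists of a single ordering. An element $x$ is initial if, in any ordering of $\Omega$ in which $x$ is not the first element, swapping $x$ with its immediate predecessor produces another ordering of $\Omega$. An element $y$ is final if, in any ordering of $\Omega$ in which $y$ is not the last element, swapping $y$ with its immediate successor produces another ordering of $\Omega$. -}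

module Defs where

open import Data.Nat using (ℕ; zero; suc; _+_; _*_; _≤_; _<_; _<?_)
open import Data.Fin using (Fin)
open import Data.Fin.Properties using () renaming (_≟_ to _≟ᶠ_)
open import Data.Fin.Subset using (Subset; _∈_; ∣_∣)
open import Data.Vec using (Vec; []; _∷_; toList)
open import Data.List using (List; length; filter)
open import Data.List.Relation.Unary.Unique.Propositional using (Unique)
open import Data.List.Membership.Propositional using () renaming (_∈_ to _∈ˡ_)
open import Data.Product using (Σ; ∃; ∃-syntax; _×_)
open import Data.Sum using (_⊎_)
open import Relation.Binary.PropositionalEquality using (_≡_; _≢_)
open import Relation.Nullary using (yes; no)

-- The ground set S is Fin n.  A total ordering of S is a vector listing
-- every element of S exactly once (first entry = earliest element).
Ordering : ℕ → Set
Ordering n = Vec (Fin n) n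

IsOrdering : ∀ {n} → Ordering n → Set
IsOrdering v = Unique (toList v)

record SetOfOrderings (n : ℕ) : Set where
  field
    orders    : List (Ordering n)
    allOrd    : ∀ v → v ∈ˡ orders → IsOrdering v
    distinct  : Unique orders
    nonempty  : 1 ≤ length orders
open SetOfOrderings public

-- position (0-based) of x in v (n if absent; never happens for orderings)
pos : ∀ {n m} → Vec (Fin n) m → Fin n → ℕ
pos [] x = 0
pos (a ∷ v) x with a ≟ᶠ x
... | yes _ = 0
... | no  _ = suc (pos v x)

-- swap the entries at positions k and k+1 (identity if out of range)
swapAdj : ∀ {A : Set} {m} → Vec A m → ℕ → Vec A m
swapAdj (a ∷ b ∷ v) zero    = b ∷ a ∷ v
swapAdj (a ∷ v)     (suc k) = a ∷ swapAdj v k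
swapAdj v           _       = v

module _ {n : ℕ} (Ω : SetOfOrderings n) where

  countBefore : Fin n → Fin n → ℕ
  countBefore x y = length (filter (λ v → pos v x <? pos v y) (orders Ω))

  -- Pr[x<y] = countBefore x y / |Ω| ;  1/3 ≤ Pr[x<y] ≤ 2/3, cross-multiplied
  BalancedPair : Fin n → Fin n → Set
  BalancedPair x y =
    length (orders Ω) ≤ 3 * countBefore x y × 3 * countBefore x y ≤ 2 * length (orders Ω)

  Balanced : Set
  Balanced = (∃[ x ] ∃[ y ] (x ≢ y × BalancedPair x y)) ⊎ length (orders Ω) ≡ 1

  Initial : Fin n → Set
  Initial x = ∀ v → v ∈ˡ orders Ω → ∀ k → pos v x ≡ suc k → swapAdj v k ∈ˡ orders Ω

  Final : Fin n → Set
  Final y = ∀ v → v ∈ˡ orders Ω → ∀ k → pos v y ≡ k → suc k < n → swapAdj v k ∈ˡ orders Ω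

  AtLeastHalf : (Fin n → Set) → Set
  AtLeastHalf P = Σ (Subset n) λ p → (∀ x → x ∈ p → P x) × n ≤ 2 * ∣ p ∣

{-# OPTIONS --safe #-}

-- Suppose that no pair is balanced, and write N = |Ω|.  "x precedes y in
-- more than 2/3 of the orderings" is then a strict linear order; let x be
-- its greatest and y its second greatest element among the k ≥ n/2 initial
-- elements.  Let d be the position of y after deletion of x.
--
-- * Shifting x forward preserves d, so for each value of d the number of
--   orderings with x at position p decreases with p.  Hence the first d + 1
--   of the n positions carry at least the fraction (d + 1)/n, that is
--   ∑ (d + 1) ≤ n #[x < y] < n N / 3.
-- * Each of the k - 2 smaller initial elements contributes more than 2N/3
--   to ∑ d.  Moreover, for one such element i, transposing i and y shows
--   #[i < y, only initial elements before y] ≤ #[y < i] < N/3, so more than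
--   N/3 orderings have a non-initial element before y.
--   Hence ∑ d > (k - 2) 2N/3 + N/3 ≥ (n/3 - 1) N, contradicting the above.
--
-- Only the ranks of the elements matter, so final elements are treated by
-- counting positions from the end.
module Submission where

open import Defs
open import Data.Fin using (Fin; zero; suc; toℕ; fromℕ<)
open import Data.Fin.Permutation.Components using (transpose; transpose-inverse)
import Data.Fin.Properties as Fin
open import Data.Fin.Subset using (Subset; ∣_∣; inside; outside) renaming (_∈_ to _∈ˢ_)
open import Data.List using (List; []; _∷_; _++_; length; filter; map; upTo; allFin)
import Data.List.Membership.DecPropositional as DecMembership
open import Data.List.Membership.Propositional using (_∈_; _∉_)
open import Data.List.Membership.Propositional.Properties using (∈-∃++; ∈-++⁻; ∈-++⁺ˡ; ∈-++⁺ʳ; ∈-filter⁺; ∈-filter⁻; ∈-map⁻; ∈-upTo⁺; ∈-allFin)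
open import Data.List.Properties using (length-++-sucʳ; length-upTo; length-tabulate; length-map)
open import Data.List.Relation.Binary.Permutation.Propositional using (_↭_; ↭-refl; ↭-sym; ↭-trans; prep; swap; ↭⇒↭ₛ)
open import Data.List.Relation.Binary.Permutation.Propositional.Properties using (All-resp-↭; ∈-resp-↭; ↭-length)
import Data.List.Relation.Binary.Permutation.Setoid.Properties as Permutationₛ
open import Data.List.Relation.Unary.All as All using (All; []; _∷_)
open import Data.List.Relation.Unary.AllPairs using ([]; _∷_)
open import Data.List.Relation.Unary.Any using (here; there)
open import Data.List.Relation.Unary.Unique.Propositional using (Unique)
import Data.List.Relation.Unary.Unique.Propositional.Properties as Unique
open import Data.Nat hiding (Ordering)
open import Data.Nat.Properties
open import Data.Nat.Solver using (module +-*-Solver)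
open import Data.Product using (∃-syntax; ∃₂; _×_; _,_; proj₁; proj₂)
open import Data.Sum using (_⊎_; inj₁; inj₂)
open import Data.Vec using (Vec; []; _∷_; lookup; tabulate; toList; here; there)
open import Data.Vec.Properties using (tabulate∘lookup; tabulate-cong; length-toList)
open import Function using (_∘_)
open import Relation.Binary.PropositionalEquality
open import Relation.Nullary using (¬_; Dec; yes; no; contradiction; ¬?; _×-dec_)
open import Relation.Nullary.Decidable using (decidable-stable)

open +-*-Solver using (solve; _:+_; _:*_; _:=_; con)

private variable
  A B : Set
  m n : ℕ

-- Counting

-- A left-unique relation plays the role of an injection, so that no
-- choice of a function (or decidable equality) is needed.
length-≤-injection : (T : A → B → Set) {xs : List A} {ys : List B} → Unique xs →
  (∀ {x} → x ∈ xs → ∃[ y ] y ∈ ys × T x y) →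
  (∀ {x x′ y} → x ∈ xs → x′ ∈ xs → T x y → T x′ y → x ≡ x′) →
  length xs ≤ length ys
length-≤-injection T {[]} _ _ _ = z≤n
length-≤-injection T {x ∷ xs} (x∉xs ∷ xs!) image injective
  with image (here refl)
... | y , y∈ys , Txy with ∈-∃++ y∈ys
... | as , bs , refl = begin
  suc (length xs)           ≤⟨ s≤s (length-≤-injection T xs! image′ (λ p q → injective (there p) (there q))) ⟩
  suc (length (as ++ bs))   ≡⟨ length-++-sucʳ as y bs ⟨
  length (as ++ y ∷ bs)     ∎
  where
  open ≤-Reasoning
  image′ : ∀ {x′} → x′ ∈ xs → ∃[ y′ ] y′ ∈ as ++ bs × T x′ y′
  image′ x′∈xs with image (there x′∈xs)
  ... | y′ , y′∈ , Tx′y′ with ∈-++⁻ as y′∈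
  ... | inj₁ y′∈as = y′ , ∈-++⁺ˡ y′∈as , Tx′y′
  ... | inj₂ (there y′∈bs) = y′ , ∈-++⁺ʳ as y′∈bs , Tx′y′
  ... | inj₂ (here refl) =
    contradiction (injective (here refl) (there x′∈xs) Txy Tx′y′) (All.lookup x∉xs x′∈xs)

𝟙 : ∀ {P : Set} → Dec P → ℕ
𝟙 (yes _) = 1
𝟙 (no _)  = 0

𝟙-mono : ∀ {P Q : Set} (P? : Dec P) (Q? : Dec Q) → (P → Q) → 𝟙 P? ≤ 𝟙 Q?
𝟙-mono (no _)  _       _ = z≤n
𝟙-mono (yes _) (yes _) _ = ≤-refl
𝟙-mono (yes p) (no ¬q) f = contradiction (f p) ¬q

𝟙-× : ∀ {P Q : Set} (P? : Dec P) (Q? : Dec Q) → 𝟙 (P? ×-dec Q?) ≡ 𝟙 P? * 𝟙 Q?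
𝟙-× (yes _) (yes _) = refl
𝟙-× (yes _) (no _)  = refl
𝟙-× (no _)  _       = refl

𝟙-yes : ∀ {P : Set} (P? : Dec P) → P → 𝟙 P? ≡ 1
𝟙-yes (yes _) _ = refl
𝟙-yes (no ¬p) p = contradiction p ¬p

∑ : List A → (A → ℕ) → ℕ
∑ []       f = 0
∑ (x ∷ xs) f = f x + ∑ xs f

private
  +-interchange : ∀ a b c d → (a + b) + (c + d) ≡ (a + c) + (b + d)
  +-interchange = solve 4 (λ a b c d → (a :+ b) :+ (c :+ d) := (a :+ c) :+ (b :+ d)) refl

∑-mono : (xs : List A) {f g : A → ℕ} → (∀ {x} → x ∈ xs → f x ≤ g x) → ∑ xs f ≤ ∑ xs g
∑-mono []       h = z≤n
∑-mono (x ∷ xs) h = +-mono-≤ (h (here refl)) (∑-mono xs (h ∘ there))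

∑-cong : (xs : List A) {f g : A → ℕ} → (∀ {x} → x ∈ xs → f x ≡ g x) → ∑ xs f ≡ ∑ xs g
∑-cong xs h = ≤-antisym (∑-mono xs (≤-reflexive ∘ h)) (∑-mono xs (≤-reflexive ∘ sym ∘ h))

∑-+ : (xs : List A) (f g : A → ℕ) → ∑ xs (λ x → f x + g x) ≡ ∑ xs f + ∑ xs g
∑-+ []       f g = refl
∑-+ (x ∷ xs) f g = trans (cong ((f x + g x) +_) (∑-+ xs f g)) (+-interchange (f x) (g x) _ _)

∑-const : (xs : List A) (c : ℕ) → ∑ xs (λ _ → c) ≡ length xs * c
∑-const []       c = refl
∑-const (x ∷ xs) c = cong (c +_) (∑-const xs c)

∑-*ˡ : (xs : List A) (c : ℕ) (f : A → ℕ) → c * ∑ xs f ≡ ∑ xs (λ x → c * f x)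
∑-*ˡ []       c f = *-zeroʳ c
∑-*ˡ (x ∷ xs) c f = trans (*-distribˡ-+ c (f x) _) (cong (c * f x +_) (∑-*ˡ xs c f))

∑-comm : (xs : List A) (ys : List B) (f : A → B → ℕ) →
  ∑ xs (λ x → ∑ ys (f x)) ≡ ∑ ys (λ y → ∑ xs (λ x → f x y))
∑-comm []       ys f = sym (trans (∑-const ys 0) (*-zeroʳ (length ys)))
∑-comm (x ∷ xs) ys f = trans (cong (∑ ys (f x) +_) (∑-comm xs ys f)) (sym (∑-+ ys (f x) _))

∑-𝟙 : {P : A → Set} (P? : ∀ x → Dec (P x)) (xs : List A) → ∑ xs (𝟙 ∘ P?) ≡ length (filter P? xs)
∑-𝟙 P? [] = refl
∑-𝟙 P? (x ∷ xs) with P? x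
... | yes _ = cong suc (∑-𝟙 P? xs)
... | no _  = ∑-𝟙 P? xs

-- Compares how many orderings have two properties. In use, `T v w` describes the ranks of `w` in
-- terms of those of `v`, so only the existence of a suitable `w` has to be shown.
∑-𝟙-injection : {P Q : A → Set} (P? : ∀ x → Dec (P x)) (Q? : ∀ x → Dec (Q x))
  (T : A → A → Set) {xs : List A} → Unique xs →
  (∀ {x} → x ∈ xs → P x → ∃[ y ] y ∈ xs × Q y × T x y) →
  (∀ {x x′ y} → x ∈ xs → x′ ∈ xs → T x y → T x′ y → x ≡ x′) →
  ∑ xs (𝟙 ∘ P?) ≤ ∑ xs (𝟙 ∘ Q?)
∑-𝟙-injection {P = P} {Q} P? Q? T {xs} xs! image injective = begin
  ∑ xs (𝟙 ∘ P?)          ≡⟨ ∑-𝟙 P? xs ⟩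
  length (filter P? xs)  ≤⟨ length-≤-injection T (Unique.filter⁺ P? xs!) image′ (λ p q → injective (∈xs p) (∈xs q)) ⟩
  length (filter Q? xs)  ≡⟨ ∑-𝟙 Q? xs ⟨
  ∑ xs (𝟙 ∘ Q?)          ∎
  where
  open ≤-Reasoning
  ∈xs : ∀ {x} → x ∈ filter P? xs → x ∈ xs
  ∈xs = proj₁ ∘ ∈-filter⁻ P?
  image′ : ∀ {x} → x ∈ filter P? xs → ∃[ y ] y ∈ filter Q? xs × T x y
  image′ x∈ with ∈-filter⁻ P? x∈
  ... | x∈xs , Px with image x∈xs Px
  ... | y , y∈xs , Qy , Txy = y , ∈-filter⁺ Q? y∈xs Qy , Txy

-- Sums over initial segments of the natural numbers

∑< : ℕ → (ℕ → ℕ) → ℕ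
∑< zero    f = 0
∑< (suc n) f = ∑< n f + f n

∑<-mono : ∀ n {f g : ℕ → ℕ} → (∀ {i} → i < n → f i ≤ g i) → ∑< n f ≤ ∑< n g
∑<-mono zero    h = z≤n
∑<-mono (suc n) h = +-mono-≤ (∑<-mono n (h ∘ m≤n⇒m≤1+n)) (h ≤-refl)

∑<-cong : ∀ n {f g : ℕ → ℕ} → (∀ {i} → i < n → f i ≡ g i) → ∑< n f ≡ ∑< n g
∑<-cong n h = ≤-antisym (∑<-mono n (≤-reflexive ∘ h)) (∑<-mono n (≤-reflexive ∘ sym ∘ h))

∑<-∑-comm : ∀ n (xs : List A) (f : ℕ → A → ℕ) →
  ∑< n (λ i → ∑ xs (f i)) ≡ ∑ xs (λ x → ∑< n (λ i → f i x))
∑<-∑-comm zero    xs f = sym (trans (∑-const xs 0) (*-zeroʳ (length xs)))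
∑<-∑-comm (suc n) xs f = trans (cong (_+ ∑ xs (f n)) (∑<-∑-comm n xs f)) (sym (∑-+ xs _ (f n)))

∑<-pick : ∀ n t (g : ℕ → ℕ) → ∑< n (λ i → 𝟙 (t ≟ i) * g i) ≡ 𝟙 (t <? n) * g t
∑<-pick zero t g with t <? 0
... | no _ = refl
∑<-pick (suc n) t g rewrite ∑<-pick n t g with t ≟ n | t <? n | t <? suc n
... | yes refl | yes t<t | _        = contradiction t<t (<-irrefl refl)
... | yes refl | no _    | yes _    = refl
... | yes refl | no _    | no t≮1+t = contradiction ≤-refl t≮1+t
... | no _     | yes _   | yes _    = +-identityʳ _
... | no _     | yes t<n | no t≮1+n = contradiction (m≤n⇒m≤1+n t<n) t≮1+n
... | no t≢n   | no t≮n  | yes t<1+n = contradiction (≤∧≢⇒< (s≤s⁻¹ t<1+n) t≢n) t≮n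
... | no _     | no _    | no _     = refl

∑<-≥ : ∀ m {c} (f : ℕ → ℕ) → (∀ {i} → i < m → c ≤ f i) → m * c ≤ ∑< m f
∑<-≥ zero    f h = z≤n
∑<-≥ (suc m) {c} f h = begin
  c + m * c     ≤⟨ +-mono-≤ (h ≤-refl) (∑<-≥ m f (h ∘ m≤n⇒m≤1+n)) ⟩
  f m + ∑< m f  ≡⟨ +-comm (f m) _ ⟩
  ∑< m f + f m  ∎
  where open ≤-Reasoning

antitone : {f : ℕ → ℕ} → (∀ i → f (suc i) ≤ f i) → ∀ {i j} → i ≤′ j → f j ≤ f i
antitone step ≤′-refl        = ≤-refl
antitone step (≤′-step i≤j) = ≤-trans (step _) (antitone step i≤j)

-- For a decreasing sequence, the average of the first `m` terms is at least that of the first `n`,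
-- here cross-multiplied. Each further term `f n` is at most every one of the first `m`, so
-- `m * f n` is at most their sum.
∑<-antitone : {f : ℕ → ℕ} → (∀ i → f (suc i) ≤ f i) → ∀ {m n} → m ≤′ n →
  m * ∑< n f ≤ n * ∑< m f
∑<-antitone step ≤′-refl = ≤-refl
∑<-antitone {f} step {m} {suc n} (≤′-step m≤n) = begin
  m * (∑< n f + f n)      ≡⟨ *-distribˡ-+ m _ (f n) ⟩
  m * ∑< n f + m * f n    ≤⟨ +-mono-≤ (∑<-antitone step m≤n) (∑<-≥ m f early) ⟩
  n * ∑< m f + ∑< m f     ≡⟨ +-comm (n * ∑< m f) _ ⟩
  suc n * ∑< m f          ∎
  where
  open ≤-Reasoning
  early : ∀ {i} → i < m → f n ≤ f i
  early i<m = antitone step (≤⇒≤′ (≤-trans (<⇒≤ i<m) (≤′⇒≤ m≤n)))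

-- Swapping two adjacent ranks, and deleting a rank

swapℕ : ℕ → ℕ → ℕ
swapℕ zero    zero          = 1
swapℕ zero    (suc zero)    = 0
swapℕ zero    (suc (suc t)) = suc (suc t)
swapℕ (suc k) zero          = zero
swapℕ (suc k) (suc t)       = suc (swapℕ k t)

swapℕ-involutive : ∀ k t → swapℕ k (swapℕ k t) ≡ t
swapℕ-involutive zero    zero          = refl
swapℕ-involutive zero    (suc zero)    = refl
swapℕ-involutive zero    (suc (suc t)) = refl
swapℕ-involutive (suc k) zero          = refl
swapℕ-involutive (suc k) (suc t)       = cong suc (swapℕ-involutive k t)

swapℕ-k : ∀ k → swapℕ k k ≡ suc k
swapℕ-k zero    = refl
swapℕ-k (suc k) = cong suc (swapℕ-k k)

swapℕ-1+k : ∀ k → swapℕ k (suc k) ≡ k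
swapℕ-1+k zero    = refl
swapℕ-1+k (suc k) = cong suc (swapℕ-1+k k)

swapℕ-other : ∀ k t → t ≢ k → t ≢ suc k → swapℕ k t ≡ t
swapℕ-other zero    zero          t≢k _   = contradiction refl t≢k
swapℕ-other zero    (suc zero)    _ t≢1+k = contradiction refl t≢1+k
swapℕ-other zero    (suc (suc t)) _ _     = refl
swapℕ-other (suc k) zero          _ _     = refl
swapℕ-other (suc k) (suc t) t≢k t≢1+k =
  cong suc (swapℕ-other k t (t≢k ∘ cong suc) (t≢1+k ∘ cong suc))

swapℕ-< : ∀ k {t b} → suc k < b → t < b → swapℕ k t < b
swapℕ-< zero    {zero}        1<b _   = 1<b
swapℕ-< zero    {suc zero}    1<b _   = ≤-trans (s≤s z≤n) 1<b
swapℕ-< zero    {suc (suc t)} _   t<b = t<b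
swapℕ-< (suc k) {zero}        _   t<b = t<b
swapℕ-< (suc k) {suc t} (s≤s k<b) (s≤s t<b) = s≤s (swapℕ-< k k<b t<b)

-- Reversal conjugates the swap of `k` and `suc k` into the swap of their mirror images, the lower
-- of which is `m ∸ suc k`. The bounds keep truncated subtraction injective.
swapℕ-∸ : ∀ m k t → suc k ≤ m → t ≤ m → swapℕ (m ∸ suc k) (m ∸ t) ≡ m ∸ swapℕ k t
swapℕ-∸ m k t k<m t≤m with t ≟ k | t ≟ suc k
... | yes refl | _ rewrite swapℕ-k t | +-∸-assoc 1 k<m = swapℕ-1+k (m ∸ suc k)
... | no _ | yes refl rewrite swapℕ-1+k k = trans (swapℕ-k (m ∸ suc k)) (sym (+-∸-assoc 1 k<m))
... | no t≢k | no t≢1+k rewrite swapℕ-other k t t≢k t≢1+k =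
  swapℕ-other _ _ (t≢1+k ∘ ∸-cancelˡ-≡ t≤m k<m)
    (λ eq → t≢k (∸-cancelˡ-≡ t≤m (<⇒≤ k<m) (trans eq (sym (+-∸-assoc 1 k<m)))))

-- delete a b is the rank of the element of rank b once the element of
-- rank a ≢ b has been removed; delete a a = a is a junk value.
delete : ℕ → ℕ → ℕ
delete zero    zero    = zero
delete zero    (suc b) = b
delete (suc a) zero    = zero
delete (suc a) (suc b) = suc (delete a b)

-- When an element moves forward from rank `suc k` to rank `k`, the order of the others does not
-- change. The excluded `b` is the rank of the moving element itself.
delete-swapℕ : ∀ k {b} → b ≢ suc k → delete k (swapℕ k b) ≡ delete (suc k) b
delete-swapℕ zero    {zero}        _ = refl
delete-swapℕ zero    {suc zero}    b≢1+k = contradiction refl b≢1+k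
delete-swapℕ zero    {suc (suc b)} _ = refl
delete-swapℕ (suc k) {zero}        _ = refl
delete-swapℕ (suc k) {suc b}       b≢1+k = cong suc (delete-swapℕ k (b≢1+k ∘ cong suc))

𝟙-suc : ∀ a b → 𝟙 (suc a <? suc b) ≡ 𝟙 (a <? b)
𝟙-suc a b = ≤-antisym (𝟙-mono (suc a <? suc b) (a <? b) s≤s⁻¹) (𝟙-mono (a <? b) (suc a <? suc b) s≤s)

-- Removing rank `a` lowers `b` by one exactly when `a < b`; on the diagonal this holds by the junk
-- value. Stated additively to avoid truncated subtraction.
delete-+ : ∀ a b → 𝟙 (a <? b) + delete a b ≡ b
delete-+ zero    zero    = refl
delete-+ zero    (suc b) = refl
delete-+ (suc a) zero    = refl
delete-+ (suc a) (suc b) = trans (+-suc _ _)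
  (cong suc (trans (cong (_+ delete a b) (𝟙-suc a b)) (delete-+ a b)))

delete-≤ : ∀ a b → delete a b ≤ b
delete-≤ a b = subst (delete a b ≤_) (delete-+ a b) (m≤n+m _ (𝟙 (a <? b)))

≤-delete⇒≤ : ∀ {a b} → a ≤ delete a b → a ≤ b
≤-delete⇒≤ {a} {b} a≤ = ≤-trans a≤ (delete-≤ a b)

-- Permuted lists and greatest elements

Unique-resp-↭ : {xs ys : List A} → xs ↭ ys → Unique xs → Unique ys
Unique-resp-↭ {A = A} p = Permutationₛ.Unique-resp-↭ (setoid A) (↭⇒↭ₛ p)

-- Compares the head with the greatest element of the tail; uniqueness supplies the distinctness
-- that totality asks for.
extract-maximum : (R : A → A → Set) → (∀ {a b} → a ≢ b → R a b ⊎ R b a) →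
  (∀ {a b c} → R a b → R b c → R a c) → ∀ a as → Unique (a ∷ as) →
  ∃₂ λ m rest → a ∷ as ↭ m ∷ rest × All (λ i → R i m) rest
extract-maximum R total R-trans a [] _ = a , [] , ↭-refl , []
extract-maximum R total R-trans a (b ∷ bs) (a∉bs ∷ bs!)
  with extract-maximum R total R-trans b bs bs!
... | m , rest , perm , max
  with total (All.lookup a∉bs (∈-resp-↭ (↭-sym perm) (here refl)))
... | inj₁ Ram = m , a ∷ rest , ↭-trans (prep a perm) (swap a m ↭-refl) , Ram ∷ max
... | inj₂ Rma = a , m ∷ rest , prep a perm , Rma ∷ All.map (λ Rim → R-trans Rim Rma) max

-- Families of rankings

-- Keeps only the ranks, so that counting positions from the end gives another instance. `Shiftable`
-- then expresses `Initial` for one direction and `Final` for the other. `rank-determines` lets maps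
-- between members be proved injective by comparing ranks.
record RankedFamily (n : ℕ) : Set₁ where
  field
    Carrier         : Set
    members         : List Carrier
    members!        : Unique members
    rank            : Carrier → Fin n → ℕ
    rank<n          : ∀ {v} → v ∈ members → ∀ u → rank v u < n
    rank-injective  : ∀ {v} → v ∈ members → ∀ {u w} → rank v u ≡ rank v w → u ≡ w
    rank-surjective : ∀ {v} → v ∈ members → ∀ {t} → t < n → ∃[ u ] rank v u ≡ t
    rank-determines : ∀ {v w} → v ∈ members → w ∈ members → rank v ≗ rank w → v ≡ w

  size : ℕ
  size = length members

  before : Fin n → Fin n → ℕ
  before x y = ∑ members (λ v → 𝟙 (rank v x <? rank v y))

  Shiftable : Fin n → Set
  Shiftable x = ∀ {v} → v ∈ members → ∀ {k} → rank v x ≡ suc k →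
    ∃[ w ] w ∈ members × (∀ u → rank w u ≡ swapℕ k (rank v u))

  reduced : Fin n → Fin n → Carrier → ℕ
  reduced x y v = delete (rank v x) (rank v y)

  MiddlePair : Fin n → Fin n → Set
  MiddlePair x y = size ≤ 3 * before x y × 3 * before x y ≤ 2 * size

module _ {n : ℕ} (Φ : RankedFamily n) where
  open RankedFamily Φ
  open ≤-Reasoning

  before-complement : ∀ {x y} → x ≢ y → before x y + before y x ≡ size
  before-complement {x} {y} x≢y = begin-equality
    before x y + before y x
      ≡⟨ ∑-+ members _ _ ⟨
    ∑ members (λ v → 𝟙 (rank v x <? rank v y) + 𝟙 (rank v y <? rank v x))
      ≡⟨ ∑-cong members one ⟩
    ∑ members (λ _ → 1)
      ≡⟨ ∑-const members 1 ⟩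
    size * 1
      ≡⟨ *-identityʳ size ⟩
    size ∎
    where
    one : ∀ {v} → v ∈ members → 𝟙 (rank v x <? rank v y) + 𝟙 (rank v y <? rank v x) ≡ 1
    one {v} v∈ with rank v x <? rank v y | rank v y <? rank v x
    ... | yes x<y | yes y<x = contradiction y<x (<-asym x<y)
    ... | yes _   | no _    = refl
    ... | no _    | yes _   = refl
    ... | no x≮y  | no y≮x  =
      contradiction (rank-injective v∈ (≤-antisym (≮⇒≥ y≮x) (≮⇒≥ x≮y))) x≢y

  -- If `x < y` and `y < z` both hold then so does `x < z`; hence where `x < z` fails, at most one
  -- of the two is counted.
  before-triangle : ∀ x y z → before x y + before y z ≤ before x z + size
  before-triangle x y z = begin
    before x y + before y z
      ≡⟨ ∑-+ members _ _ ⟨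
    ∑ members (λ v → 𝟙 (rank v x <? rank v y) + 𝟙 (rank v y <? rank v z))
      ≤⟨ ∑-mono members (λ {v} _ → pointwise v) ⟩
    ∑ members (λ v → 𝟙 (rank v x <? rank v z) + 1)
      ≡⟨ ∑-+ members _ _ ⟩
    before x z + ∑ members (λ _ → 1)
      ≡⟨ cong (before x z +_) (trans (∑-const members 1) (*-identityʳ size)) ⟩
    before x z + size ∎
    where
    pointwise : ∀ v → 𝟙 (rank v x <? rank v y) + 𝟙 (rank v y <? rank v z) ≤ 𝟙 (rank v x <? rank v z) + 1
    pointwise v with rank v x <? rank v y | rank v y <? rank v z | rank v x <? rank v z
    ... | yes _   | yes _   | yes _  = ≤-refl
    ... | yes x<y | yes y<z | no x≮z = contradiction (<-trans x<y y<z) x≮z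
    ... | yes _   | no _    | _      = m≤n+m 1 _
    ... | no _    | yes _   | _      = m≤n+m 1 _
    ... | no _    | no _    | _      = z≤n

  -- Pigeonhole: distinct elements have distinct ranks below `t`.
  length≤rank : ∀ {v} → v ∈ members → ∀ {t} {us : List (Fin n)} → Unique us →
    (∀ {u} → u ∈ us → rank v u < t) → length us ≤ t
  length≤rank {v} v∈ {t} {us} us! below = begin
    length us        ≤⟨ length-≤-injection (λ u a → rank v u ≡ a) us!
                          (λ u∈ → _ , ∈-upTo⁺ (below u∈) , refl)
                          (λ _ _ p q → rank-injective v∈ (trans p (sym q))) ⟩
    length (upTo t)  ≡⟨ length-upTo t ⟩
    t                ∎

  -- Averaging over the positions of a shiftable element

  module _ {x : Fin n} (x-shiftable : Shiftable x) {y : Fin n} (x≢y : x ≢ y) where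

    private
      cell : ℕ → ℕ → ℕ
      cell j p = ∑ members (λ v → 𝟙 ((rank v x ≟ p) ×-dec (reduced x y v ≟ j)))

      -- Moving `x` one place forward maps the cell at position `suc p` injectively into the cell at
      -- position `p`, and leaves the reduced position `j` of `y` unchanged.
      cell-antitone : ∀ j p → cell j (suc p) ≤ cell j p
      cell-antitone j p = ∑-𝟙-injection _ _ (λ v w → ∀ u → rank w u ≡ swapℕ p (rank v u)) members! image injective
        where
        image : ∀ {v} → v ∈ members → rank v x ≡ suc p × reduced x y v ≡ j →
          ∃[ w ] w ∈ members × (rank w x ≡ p × reduced x y w ≡ j) × (∀ u → rank w u ≡ swapℕ p (rank v u))
        image {v} v∈ (x-at , red) with x-shiftable v∈ x-at
        ... | w , w∈ , shift = w , w∈ , (w-x , w-red) , shift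
          where
          w-x : rank w x ≡ p
          w-x = trans (shift x) (trans (cong (swapℕ p) x-at) (swapℕ-1+k p))
          w-red : reduced x y w ≡ j
          w-red = begin-equality
            delete (rank w x) (rank w y)          ≡⟨ cong₂ delete w-x (shift y) ⟩
            delete p (swapℕ p (rank v y))         ≡⟨ delete-swapℕ p (λ y-at → x≢y (rank-injective v∈ (trans x-at (sym y-at)))) ⟩
            delete (suc p) (rank v y)             ≡⟨ cong (λ a → delete a (rank v y)) x-at ⟨
            reduced x y v                             ≡⟨ red ⟩
            j                                     ∎
        injective : ∀ {v v′ w} → v ∈ members → v′ ∈ members →
          (∀ u → rank w u ≡ swapℕ p (rank v u)) → (∀ u → rank w u ≡ swapℕ p (rank v′ u)) → v ≡ v′
        injective {v} {v′} v∈ v′∈ f g = rank-determines v∈ v′∈ λ u →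
          trans (sym (swapℕ-involutive p (rank v u)))
            (trans (cong (swapℕ p) (trans (sym (f u)) (g u))) (swapℕ-involutive p (rank v′ u)))

      ∑<-cell : ∀ j m → ∑< m (cell j) ≡ ∑ members (λ v → 𝟙 (rank v x <? m) * 𝟙 (reduced x y v ≟ j))
      ∑<-cell j m = trans (∑<-∑-comm m members _) (∑-cong members λ {v} _ →
        trans (∑<-cong m (λ {p} _ → 𝟙-× (rank v x ≟ p) (reduced x y v ≟ j)))
          (∑<-pick m (rank v x) (λ _ → 𝟙 (reduced x y v ≟ j))))

      reduced<n : ∀ {v} → v ∈ members → reduced x y v < n
      reduced<n {v} v∈ = ≤-<-trans (delete-≤ (rank v x) (rank v y)) (rank<n v∈ y)

      -- Regroups the orderings by the reduced position `j` of `y`, admitting only the first `m j`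
      -- positions of `x` and giving each ordering weight `a j`. It serves once with all `n`
      -- positions and once with the first `suc j`.
      ∑<-weighted-cell : ∀ (a m : ℕ → ℕ) →
        ∑< n (λ j → a j * ∑< (m j) (cell j)) ≡
        ∑ members (λ v → a (reduced x y v) * 𝟙 (rank v x <? m (reduced x y v)))
      ∑<-weighted-cell a m = begin-equality
        ∑< n (λ j → a j * ∑< (m j) (cell j))
          ≡⟨ ∑<-cong n (λ {j} _ → trans (cong (a j *_) (∑<-cell j (m j))) (∑-*ˡ members (a j) _)) ⟩
        ∑< n (λ j → ∑ members (λ v → a j * (𝟙 (rank v x <? m j) * 𝟙 (reduced x y v ≟ j))))
          ≡⟨ ∑<-∑-comm n members _ ⟩
        ∑ members (λ v → ∑< n (λ j → a j * (𝟙 (rank v x <? m j) * 𝟙 (reduced x y v ≟ j))))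
          ≡⟨ ∑-cong members (λ {v} v∈ → trans
               (∑<-cong n (λ {j} _ → rotate (a j) (𝟙 (rank v x <? m j)) (𝟙 (reduced x y v ≟ j))))
               (trans (∑<-pick n (reduced x y v) (λ j → a j * 𝟙 (rank v x <? m j)))
                 (trans (cong (_* (a (reduced x y v) * 𝟙 (rank v x <? m (reduced x y v)))) (𝟙-yes (reduced x y v <? n) (reduced<n v∈)))
                   (*-identityˡ _)))) ⟩
        ∑ members (λ v → a (reduced x y v) * 𝟙 (rank v x <? m (reduced x y v))) ∎
        where
        rotate : ∀ a b c → a * (b * c) ≡ c * (a * b)
        rotate = solve 3 (λ a b c → a :* (b :* c) := c :* (a :* b)) refl

    ∑-reduced-≤ : ∑ members (suc ∘ reduced x y) ≤ n * before x y
    ∑-reduced-≤ = begin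
      ∑ members (suc ∘ reduced x y)
        -- The inserted indicator is always 1; it brings the sum into the form of
        -- `∑<-weighted-cell`.
        ≡⟨ ∑-cong members (λ {v} v∈ → trans (sym (*-identityʳ _))
             (cong (suc (reduced x y v) *_) (sym (𝟙-yes (rank v x <? n) (rank<n v∈ x))))) ⟩
      ∑ members (λ v → suc (reduced x y v) * 𝟙 (rank v x <? n))
        ≡⟨ ∑<-weighted-cell suc (λ _ → n) ⟨
      ∑< n (λ j → suc j * ∑< n (cell j))
        -- For each `j`, the first `suc j` of the `n` positions of `x` carry at least the fraction
        -- `suc j / n` of the orderings.
        ≤⟨ ∑<-mono n (λ {j} j<n → ∑<-antitone (cell-antitone j) (≤⇒≤′ j<n)) ⟩
      ∑< n (λ j → n * ∑< (suc j) (cell j))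
        ≡⟨ ∑<-weighted-cell (λ _ → n) suc ⟩
      ∑ members (λ v → n * 𝟙 (rank v x <? suc (reduced x y v)))
        -- If the rank of `x` is at most the reduced rank of `y`, then `x` precedes `y`; equality of
        -- the two ranks is excluded by `x≢y`.
        ≤⟨ ∑-mono members (λ {v} v∈ → *-monoʳ-≤ n (𝟙-mono (rank v x <? suc (reduced x y v)) (rank v x <? rank v y)
             (λ p → ≤∧≢⇒< (≤-delete⇒≤ (s≤s⁻¹ p)) (x≢y ∘ rank-injective v∈)))) ⟩
      ∑ members (λ v → n * 𝟙 (rank v x <? rank v y))
        ≡⟨ ∑-*ˡ members n _ ⟨
      n * before x y ∎

-- Transposing two elements of a ranking

transpose-left : ∀ {n} (i j : Fin n) → transpose i j i ≡ j
transpose-left i j with i Fin.≟ i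
... | yes _   = refl
... | no i≢i  = contradiction refl i≢i

transpose-right : ∀ {n} (i j : Fin n) → transpose i j j ≡ i
transpose-right i j with j Fin.≟ i
... | yes j≡i = j≡i
... | no _ with j Fin.≟ j
... | yes _  = refl
... | no j≢j = contradiction refl j≢j

module _ {n : ℕ} (Φ : RankedFamily n) where
  open RankedFamily Φ
  open ≤-Reasoning

  module _ {x y : Fin n} (y-shiftable : Shiftable y) where

    -- Conjugating by the adjacent swap behind x reduces the distance of
    -- x and y; only shiftable elements are ever moved forward.
    exchange : ∀ d {v} → v ∈ members → rank v y ≡ suc d + rank v x →
      (∀ {u} → rank v u < rank v y → Shiftable u) →
      ∃[ w ] w ∈ members × (∀ u → rank w u ≡ rank v (transpose x y u))
    exchange zero {v} v∈ y-at _ with y-shiftable v∈ y-at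
    ... | w , w∈ , shift = w , w∈ , λ u → trans (shift u) (moved u)
      where
      moved : ∀ u → swapℕ (rank v x) (rank v u) ≡ rank v (transpose x y u)
      moved u with u Fin.≟ x
      ... | yes refl = trans (swapℕ-k (rank v u)) (sym y-at)
      ... | no u≢x with u Fin.≟ y
      ... | yes refl = trans (cong (swapℕ (rank v x)) y-at) (swapℕ-1+k (rank v x))
      ... | no u≢y = swapℕ-other _ _ (u≢x ∘ rank-injective v∈)
                       (λ eq → u≢y (rank-injective v∈ (trans eq (sym y-at))))
    exchange (suc d) {v} v∈ y-at prefix = moved-back
      where
      k = rank v x
      1+k<y : suc k < rank v y
      1+k<y = subst (suc k <_) (sym y-at) (s≤s (s≤s (m≤n+m k d)))
      y-fixed : swapℕ k (rank v y) ≡ rank v y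
      y-fixed = swapℕ-other k _ (λ eq → <-irrefl (sym eq) (<⇒≤ 1+k<y)) (λ eq → <-irrefl (sym eq) 1+k<y)
      moved-back : ∃[ w ] w ∈ members × (∀ u → rank w u ≡ rank v (transpose x y u))
      moved-back with rank-surjective v∈ (<-trans 1+k<y (rank<n v∈ y))
      -- `e` stands directly behind `x` and ahead of `y`, so it is shiftable; moving it forward
      -- pushes `x` one place closer to `y`.
      ... | e , e-at with prefix (subst (_< rank v y) (sym e-at) 1+k<y) v∈ e-at
      ... | v₁ , v₁∈ , shift₁ with exchange d v₁∈ y-at₁ prefix₁
        where
        y-at₁ : rank v₁ y ≡ suc d + rank v₁ x
        y-at₁ = begin-equality
          rank v₁ y              ≡⟨ trans (shift₁ y) y-fixed ⟩
          rank v y               ≡⟨ y-at ⟩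
          suc (suc d + k)        ≡⟨ +-suc (suc d) k ⟨
          suc d + suc k          ≡⟨ cong (suc d +_) (trans (shift₁ x) (swapℕ-k k)) ⟨
          suc d + rank v₁ x      ∎
        prefix₁ : ∀ {u} → rank v₁ u < rank v₁ y → Shiftable u
        -- The swap only permutes ranks below that of `y`, so the elements before `y` are the same
        -- in `v₁` as in `v`.
        prefix₁ {u} u<y = prefix (subst (_< rank v y)
          (trans (cong (swapℕ k) (shift₁ u)) (swapℕ-involutive k (rank v u)))
          (swapℕ-< k 1+k<y (subst (rank v₁ u <_) (trans (shift₁ y) y-fixed) u<y)))
      -- In `v₂`, `y` has taken the place of `x` at rank `suc k`, directly behind `e`. Moving `y`
      -- forward puts `e` back at its original rank.
      ... | v₂ , v₂∈ , shift₂ with y-shiftable v₂∈ y-at₂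
        where
        y-at₂ : rank v₂ y ≡ suc k
        y-at₂ = begin-equality
          rank v₂ y                     ≡⟨ shift₂ y ⟩
          rank v₁ (transpose x y y)     ≡⟨ cong (rank v₁) (transpose-right x y) ⟩
          rank v₁ x                     ≡⟨ shift₁ x ⟩
          swapℕ k k                     ≡⟨ swapℕ-k k ⟩
          suc k                         ∎
      ... | v₃ , v₃∈ , shift₃ = v₃ , v₃∈ , λ u → begin-equality
          rank v₃ u                                    ≡⟨ shift₃ u ⟩
          swapℕ k (rank v₂ u)                          ≡⟨ cong (swapℕ k) (trans (shift₂ u) (shift₁ _)) ⟩
          swapℕ k (swapℕ k (rank v (transpose x y u)))  ≡⟨ swapℕ-involutive k _ ⟩
          rank v (transpose x y u)                     ∎

  -- Elements outside a given list that precede `y`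

  module _ (ps : List (Fin n)) where
    open DecMembership (Fin._≟_ {n}) using (_∈?_)

    OutsiderBefore : Fin n → Carrier → Set
    OutsiderBefore y v = ∃[ u ] u ∉ ps × rank v u < rank v y

    outsiderBefore? : ∀ y v → Dec (OutsiderBefore y v)
    outsiderBefore? y v = Fin.any? (λ u → ¬? (u ∈? ps) ×-dec (rank v u <? rank v y))

    outsidersBefore : Fin n → ℕ
    outsidersBefore y = ∑ members (𝟙 ∘ outsiderBefore? y)

    -- Where `x` precedes `y` and no outsider does, everything before `y` is shiftable. By
    -- `exchange`, transposing `x` and `y` then injects these orderings into those with `y` before
    -- `x`.
    before-≤-outsiders : All Shiftable ps → ∀ {x y} → y ∈ ps →
      before x y ≤ outsidersBefore y + before y x
    before-≤-outsiders shiftable {x} {y} y∈ps = begin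
      before x y
        ≤⟨ ∑-mono members (λ {v} _ → split v) ⟩
      ∑ members (λ v → 𝟙 (outsiderBefore? y v) + 𝟙 (inside? v))
        ≡⟨ ∑-+ members _ _ ⟩
      outsidersBefore y + ∑ members (𝟙 ∘ inside?)
        ≤⟨ +-monoʳ-≤ _ (∑-𝟙-injection inside? (λ v → rank v y <? rank v x)
             (λ v w → ∀ u → rank w u ≡ rank v (transpose x y u)) members! image injective) ⟩
      outsidersBefore y + before y x ∎
      where
      Inside : Carrier → Set
      Inside v = rank v x < rank v y × ¬ OutsiderBefore y v
      inside? : ∀ v → Dec (Inside v)
      inside? v = (rank v x <? rank v y) ×-dec ¬? (outsiderBefore? y v)
      split : ∀ v → 𝟙 (rank v x <? rank v y) ≤ 𝟙 (outsiderBefore? y v) + 𝟙 (inside? v)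
      split v with rank v x <? rank v y | outsiderBefore? y v
      ... | no _  | _     = z≤n
      ... | yes _ | yes _ = s≤s z≤n
      ... | yes _ | no _  = s≤s z≤n
      image : ∀ {v} → v ∈ members → Inside v →
        ∃[ w ] w ∈ members × rank w y < rank w x × (∀ u → rank w u ≡ rank v (transpose x y u))
      image {v} v∈ (x<y , none)
        -- The first number is how many elements stand strictly between `x` and `y`.
        with exchange (All.lookup shiftable y∈ps) (rank v y ∸ suc (rank v x)) v∈
          (sym (trans (sym (+-suc _ (rank v x))) (m∸n+n≡m x<y)))
          (λ {u} u<y → All.lookup shiftable (decidable-stable (u ∈? ps) (λ u∉ps → none (u , u∉ps , u<y))))
      ... | w , w∈ , moved = w , w∈ , subst₂ _<_ (sym w-y) (sym w-x) x<y , moved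
        where
        w-y : rank w y ≡ rank v x
        w-y = trans (moved y) (cong (rank v) (transpose-right x y))
        w-x : rank w x ≡ rank v y
        w-x = trans (moved x) (cong (rank v) (transpose-left x y))
      injective : ∀ {v v′ w} → v ∈ members → v′ ∈ members →
        (∀ u → rank w u ≡ rank v (transpose x y u)) →
        (∀ u → rank w u ≡ rank v′ (transpose x y u)) → v ≡ v′
      injective {v} {v′} v∈ v′∈ f g = rank-determines v∈ v′∈ λ u →
        subst (λ t → rank v t ≡ rank v′ t) (transpose-inverse x y) (trans (sym (f (transpose y x u))) (g _))

    -- An outsider differs from every member of `zs`, since those lie in `ps`; so it adds one more
    -- distinct element before `y`, and `length≤rank` applies.
    rank-≥ : ∀ {v} → v ∈ members → ∀ y {zs} → Unique zs → All (_∈ ps) zs →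
      𝟙 (outsiderBefore? y v) + ∑ zs (λ z → 𝟙 (rank v z <? rank v y)) ≤ rank v y
    rank-≥ {v} v∈ y {zs} zs! zs⊆ps = bound (outsiderBefore? y v)
      where
      early? : ∀ z → Dec (rank v z < rank v y)
      early? z = rank v z <? rank v y
      early : List (Fin n)
      early = filter early? zs
      early! : Unique early
      early! = Unique.filter⁺ early? zs!
      below : ∀ {u} → u ∈ early → rank v u < rank v y
      below = proj₂ ∘ ∈-filter⁻ early? {xs = zs}
      bound : (o? : Dec (OutsiderBefore y v)) → 𝟙 o? + ∑ zs (𝟙 ∘ early?) ≤ rank v y
      bound (no _) = ≤-trans (≤-reflexive (∑-𝟙 early? zs)) (length≤rank Φ v∈ early! below)
      bound (yes (u , u∉ps , u<y)) = ≤-trans (≤-reflexive (cong suc (∑-𝟙 early? zs)))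
        (length≤rank Φ v∈ (All.tabulate fresh ∷ early!) λ { (here refl) → u<y ; (there p) → below p })
        where
        fresh : ∀ {z} → z ∈ early → u ≢ z
        fresh z∈ refl = u∉ps (All.lookup zs⊆ps (proj₁ (∈-filter⁻ early? z∈)))

    -- Apply `rank-≥` to `x ∷ rest` in each ordering. The term of `x` is exactly the difference
    -- between the rank of `y` and its reduced rank, and cancels by `delete-+`.
    ∑-reduced-≥ : ∀ {x} y {rest} → Unique (x ∷ rest) → All (_∈ ps) (x ∷ rest) →
      outsidersBefore y + ∑ rest (λ i → before i y) ≤ ∑ members (reduced x y)
    ∑-reduced-≥ {x} y {rest} us! us⊆ps = begin
      outsidersBefore y + ∑ rest (λ i → before i y)
        ≡⟨ cong (outsidersBefore y +_) (∑-comm rest members _) ⟩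
      outsidersBefore y + ∑ members (λ v → ∑ rest (λ i → 𝟙 (rank v i <? rank v y)))
        ≡⟨ ∑-+ members _ _ ⟨
      ∑ members (λ v → 𝟙 (outsiderBefore? y v) + ∑ rest (λ i → 𝟙 (rank v i <? rank v y)))
        ≤⟨ ∑-mono members pointwise ⟩
      ∑ members (reduced x y) ∎
      where
      pointwise : ∀ {v} → v ∈ members →
        𝟙 (outsiderBefore? y v) + ∑ rest (λ i → 𝟙 (rank v i <? rank v y)) ≤ reduced x y v
      pointwise {v} v∈ = +-cancelˡ-≤ ε _ _ (begin
        ε + (o + r)                        ≡⟨ solve 3 (λ a b c → a :+ (b :+ c) := b :+ (a :+ c)) refl ε o r ⟩
        o + (ε + r)                        ≤⟨ rank-≥ v∈ y us! us⊆ps ⟩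
        rank v y                           ≡⟨ delete-+ (rank v x) (rank v y) ⟨
        ε + delete (rank v x) (rank v y)   ∎)
        where
        ε = 𝟙 (rank v x <? rank v y)
        o = 𝟙 (outsiderBefore? y v)
        r = ∑ rest (λ i → 𝟙 (rank v i <? rank v y))

  before-self : ∀ x → before x x ≡ 0
  before-self x = trans (∑-cong members (λ {v} _ → never v)) (trans (∑-const members 0) (*-zeroʳ size))
    where
    never : ∀ v → 𝟙 (rank v x <? rank v x) ≡ 0
    never v with rank v x <? rank v x
    ... | yes x<x = contradiction x<x (<-irrefl refl)
    ... | no _    = refl

  -- The order by two-thirds majority

  MostlyBefore : Fin n → Fin n → Set
  MostlyBefore x y = 2 * size < 3 * before x y

  private
    mostlyBefore⇒rare : ∀ {x y} → x ≢ y → MostlyBefore x y → 3 * before y x < size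
    mostlyBefore⇒rare {x} {y} x≢y x≪y = +-cancelˡ-< (2 * size) _ _ (begin-strict
      2 * size + 3 * before y x          <⟨ +-monoˡ-< (3 * before y x) x≪y ⟩
      3 * before x y + 3 * before y x    ≡⟨ *-distribˡ-+ 3 (before x y) (before y x) ⟨
      3 * (before x y + before y x)      ≡⟨ cong (3 *_) (before-complement Φ x≢y) ⟩
      3 * size                           ≡⟨ solve 1 (λ s → con 3 :* s := con 2 :* s :+ s) refl size ⟩
      2 * size + size                    ∎)

    frequent : ∀ {x y} → x ≢ y → ¬ MostlyBefore y x → size ≤ 3 * before x y
    frequent {x} {y} x≢y y≪̸x = +-cancelʳ-≤ (2 * size) _ _ (begin
      size + 2 * size                    ≡⟨⟩
      3 * size                           ≡⟨ cong (3 *_) (before-complement Φ x≢y) ⟨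
      3 * (before x y + before y x)      ≡⟨ *-distribˡ-+ 3 (before x y) (before y x) ⟩
      3 * before x y + 3 * before y x    ≤⟨ +-monoʳ-≤ (3 * before x y) (≮⇒≥ y≪̸x) ⟩
      3 * before x y + 2 * size          ∎)

    mostlyBefore? : ∀ x y → Dec (MostlyBefore x y)
    mostlyBefore? x y = 2 * size <? 3 * before x y

  module _ (unbalanced : ∀ {x y} → x ≢ y → ¬ MiddlePair x y) where

    -- If neither direction exceeds two thirds, both are at least one third and the pair is a middle
    -- pair.
    mostlyBefore-total : ∀ {x y} → x ≢ y → MostlyBefore x y ⊎ MostlyBefore y x
    mostlyBefore-total {x} {y} x≢y with mostlyBefore? x y | mostlyBefore? y x
    ... | yes x≪y | _       = inj₁ x≪y
    ... | no _    | yes y≪x = inj₂ y≪x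
    ... | no x≪̸y  | no y≪̸x  = contradiction (frequent x≢y y≪̸x , ≮⇒≥ x≪̸y) (unbalanced x≢y)

    -- `before-triangle` puts `x` before `z` in more than 2/3 + 2/3 - 1 = 1/3 of the orderings;
    -- without a middle pair, more than 1/3 means more than 2/3.
    mostlyBefore-trans : ∀ {x y z} → MostlyBefore x y → MostlyBefore y z → MostlyBefore x z
    mostlyBefore-trans {x} {y} {z} x≪y y≪z with mostlyBefore? x z
    ... | yes x≪z = x≪z
    ... | no x≪̸z  = contradiction (<⇒≤ often , ≮⇒≥ x≪̸z) (unbalanced x≢z)
      where
      often : size < 3 * before x z
      often = +-cancelʳ-< (3 * size) _ _ (begin-strict
        size + 3 * size                    ≡⟨ solve 1 (λ s → s :+ con 3 :* s := con 2 :* s :+ con 2 :* s) refl size ⟩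
        2 * size + 2 * size                <⟨ +-mono-< x≪y y≪z ⟩
        3 * before x y + 3 * before y z    ≡⟨ *-distribˡ-+ 3 (before x y) (before y z) ⟨
        3 * (before x y + before y z)      ≤⟨ *-monoʳ-≤ 3 (before-triangle Φ x y z) ⟩
        3 * (before x z + size)            ≡⟨ *-distribˡ-+ 3 (before x z) size ⟩
        3 * before x z + 3 * size          ∎)
      -- `unbalanced` speaks of distinct elements only. No element precedes itself, so `often`
      -- excludes equality.
      x≢z : x ≢ z
      x≢z refl = n≮0 (subst (λ c → size < 3 * c) (before-self x) often)

    -- Three elements provide the greatest `x`, the second greatest `y`, and a further `i` below
    -- `y`, from which the number of orderings with an outsider before `y` is bounded.
    shiftable-minority : ∀ ps → Unique ps → All Shiftable ps → 3 ≤ length ps → 2 * length ps < n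
    shiftable-minority [] _ _ ()
    shiftable-minority ps@(p ∷ ps′) ps! shiftable 3≤
      with extract-maximum MostlyBefore mostlyBefore-total mostlyBefore-trans p ps′ ps!
    ... | x , [] , perm , _ = contradiction (subst (3 ≤_) (↭-length perm) 3≤) λ { (s≤s ()) }
    ... | x , q ∷ qs , perm , ≪x with Unique-resp-↭ perm ps!
    ... | x∉ ∷ qs! with extract-maximum MostlyBefore mostlyBefore-total mostlyBefore-trans q qs qs!
    ... | y , [] , perm′ , _ = contradiction (subst (3 ≤_) (↭-length (↭-trans perm (prep x perm′))) 3≤) λ { (s≤s (s≤s ())) }
    ... | y , rest@(i ∷ _) , perm′ , ≪y@(i≪y ∷ _) = subst (λ l → 2 * l < n) (sym (↭-length perm″)) (*-cancelʳ-< size _ _ (begin-strict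
        -- Three times the lower bound for the sum of `suc ∘ reduced x y`: `size` comes from the
        -- outsiders, `2 * size` from each element of `rest`, and `3 * size` from the successor in
        -- each ordering.
        2 * (2 + length rest) * size
          ≡⟨ solve 2 (λ k s → con 2 :* (con 2 :+ k) :* s := (s :+ k :* (con 2 :* s)) :+ con 3 :* s) refl (length rest) size ⟩
        (size + length rest * (2 * size)) + 3 * size
          ≤⟨ +-monoˡ-≤ (3 * size) (+-mono-≤ size≤ rest≤) ⟩
        (3 * outsidersBefore ps y + 3 * ∑ rest (λ i → before i y)) + 3 * size
          ≡⟨ solve 3 (λ a b c → (con 3 :* a :+ con 3 :* b) :+ con 3 :* c := con 3 :* (c :+ (a :+ b))) refl
               (outsidersBefore ps y) _ size ⟩
        3 * (size + (outsidersBefore ps y + ∑ rest (λ i → before i y)))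
          ≤⟨ *-monoʳ-≤ 3 (+-monoʳ-≤ size (∑-reduced-≥ ps y xs! xs⊆ps)) ⟩
        3 * (size + ∑ members (reduced x y))
          ≡⟨ cong (λ c → 3 * (c + ∑ members (reduced x y))) (trans (∑-const members 1) (*-identityʳ size)) ⟨
        3 * (∑ members (λ _ → 1) + ∑ members (reduced x y))
          ≡⟨ cong (3 *_) (∑-+ members _ _) ⟨
        3 * ∑ members (suc ∘ reduced x y)
          ≤⟨ *-monoʳ-≤ 3 (∑-reduced-≤ Φ x-s x≢y) ⟩
        3 * (n * before x y)
          ≡⟨ solve 2 (λ n c → con 3 :* (n :* c) := n :* (con 3 :* c)) refl n (before x y) ⟩
        n * (3 * before x y)
          -- The strict step: `y` is mostly before `x`, so `x` precedes `y` in fewer than a third of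
          -- the orderings. The element `x` also shows that `n` is nonzero.
          <⟨ *-monoʳ-< n {{Fin.nonZeroIndex x}} (mostlyBefore⇒rare (x≢y ∘ sym) y≪x) ⟩
        n * size ∎))
      where
      perm″ : ps ↭ x ∷ y ∷ rest
      perm″ = ↭-trans perm (prep x perm′)
      x-s : Shiftable x
      x-s = All.head (All-resp-↭ perm″ shiftable)
      ⊆ps : ∀ {u} → u ∈ x ∷ y ∷ rest → u ∈ ps
      ⊆ps = ∈-resp-↭ (↭-sym perm″)
      unique″ : Unique (x ∷ y ∷ rest)
      unique″ = Unique-resp-↭ perm″ ps!
      x≢y : x ≢ y
      x≢y with unique″
      ... | (x≢y ∷ _) ∷ _ = x≢y
      y≢i : y ≢ i
      y≢i with unique″
      ... | _ ∷ (y≢i ∷ _) ∷ _ = y≢i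
      xs! : Unique (x ∷ rest)
      xs! with unique″
      ... | (_ ∷ x∉rest) ∷ _ ∷ rest! = x∉rest ∷ rest!
      xs⊆ps : All (_∈ ps) (x ∷ rest)
      xs⊆ps = All.tabulate λ { (here refl) → ⊆ps (here refl) ; (there u∈) → ⊆ps (there (there u∈)) }
      y≪x : MostlyBefore y x
      y≪x = All.head (All-resp-↭ perm′ ≪x)
      rest≤ : length rest * (2 * size) ≤ 3 * ∑ rest (λ i → before i y)
      rest≤ = begin
        length rest * (2 * size)              ≡⟨ ∑-const rest (2 * size) ⟨
        ∑ rest (λ _ → 2 * size)               ≤⟨ ∑-mono rest (λ i∈ → <⇒≤ (All.lookup ≪y i∈)) ⟩
        ∑ rest (λ i → 3 * before i y)         ≡⟨ ∑-*ˡ rest 3 (λ i → before i y) ⟨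
        3 * ∑ rest (λ i → before i y)         ∎
      -- `i` precedes `y` in over two thirds of the orderings and follows it in under one third, so
      -- `before-≤-outsiders` leaves at least a third for the outsiders.
      size≤ : size ≤ 3 * outsidersBefore ps y
      size≤ = +-cancelʳ-≤ size _ _ (begin
        size + size                                                ≡⟨ cong (size +_) (+-identityʳ size) ⟨
        2 * size                                                   ≤⟨ <⇒≤ i≪y ⟩
        3 * before i y                                             ≤⟨ *-monoʳ-≤ 3 (before-≤-outsiders ps shiftable (⊆ps (there (here refl)))) ⟩
        3 * (outsidersBefore ps y + before y i)          ≡⟨ *-distribˡ-+ 3 (outsidersBefore ps y) _ ⟩
        3 * outsidersBefore ps y + 3 * before y i        ≤⟨ +-monoʳ-≤ _ (<⇒≤ (mostlyBefore⇒rare (y≢i ∘ sym) i≪y)) ⟩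
        3 * outsidersBefore ps y + size                  ∎)

  middlePair-exists : ∀ ps → Unique ps → All Shiftable ps → 3 ≤ length ps → n ≤ 2 * length ps →
    ∃[ x ] ∃[ y ] (x ≢ y × MiddlePair x y)
  middlePair-exists ps ps! shiftable 3≤ half
    -- A finite search over all pairs turns the refutation of `unbalanced` into an actual pair.
    with Fin.any? (λ x → Fin.any? (λ y → ¬? (x Fin.≟ y) ×-dec
           ((size ≤? 3 * before x y) ×-dec (3 * before x y ≤? 2 * size))))
  ... | yes found = found
  ... | no ¬found = contradiction half (<⇒≱ (shiftable-minority
          (λ {x} {y} x≢y middle → ¬found (x , y , x≢y , middle)) ps ps! shiftable 3≤))

-- Positions in an ordering

pos-head : (a : Fin n) (v : Vec (Fin n) m) → pos (a ∷ v) a ≡ 0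
pos-head a v with a Fin.≟ a
... | yes _  = refl
... | no a≢a = contradiction refl a≢a

pos-tail : {a u : Fin n} (v : Vec (Fin n) m) → a ≢ u → pos (a ∷ v) u ≡ suc (pos v u)
pos-tail {a = a} {u} v a≢u with a Fin.≟ u
... | yes a≡u = contradiction a≡u a≢u
... | no _    = refl

-- An absent element would have position `m`, so an equation with `toℕ i` for `i : Fin m` also
-- guarantees that `u` occurs.
pos⇒lookup : (v : Vec (Fin n) m) (i : Fin m) {u : Fin n} → pos v u ≡ toℕ i → lookup v i ≡ u
pos⇒lookup (a ∷ v) i {u} eq with a Fin.≟ u
pos⇒lookup (a ∷ v) zero    eq | yes a≡u = a≡u
pos⇒lookup (a ∷ v) (suc i) eq | no _    = pos⇒lookup v i (suc-injective eq)

lookup-∈ : (v : Vec A m) (i : Fin m) → lookup v i ∈ toList v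
lookup-∈ (a ∷ v) zero    = here refl
lookup-∈ (a ∷ v) (suc i) = there (lookup-∈ v i)

pos-lookup : (v : Vec (Fin n) m) → Unique (toList v) → ∀ i → pos v (lookup v i) ≡ toℕ i
pos-lookup (a ∷ v) _           zero    = pos-head a v
pos-lookup (a ∷ v) (a∉v ∷ v!) (suc i) =
  trans (pos-tail v (All.lookup a∉v (lookup-∈ v i))) (cong suc (pos-lookup v v! i))

∈⇒pos< : (v : Vec (Fin n) m) {u : Fin n} → u ∈ toList v → pos v u < m
∈⇒pos< (a ∷ v) {u} u∈ with a Fin.≟ u
∈⇒pos< (a ∷ v) u∈           | yes _  = s≤s z≤n
∈⇒pos< (a ∷ v) (here u≡a)   | no a≢u = contradiction (sym u≡a) a≢u
∈⇒pos< (a ∷ v) (there u∈v)  | no _   = s≤s (∈⇒pos< v u∈v)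

-- `pos` finds first occurrences, so swapping two equal entries would not move them; the entries are
-- therefore distinct. The bound on `k` excludes the range where `swapAdj` is the identity.
pos-swapAdj : (v : Vec (Fin n) m) → Unique (toList v) → ∀ {k} → suc k < m →
  ∀ u → pos (swapAdj v k) u ≡ swapℕ k (pos v u)
pos-swapAdj (_ ∷ []) _ (s≤s ())
pos-swapAdj (a ∷ b ∷ v) ((a≢b ∷ _) ∷ _) {zero} _ u with a Fin.≟ u
... | yes refl rewrite pos-tail (a ∷ v) (a≢b ∘ sym) | pos-head a v = refl
... | no a≢u with b Fin.≟ u
... | yes refl = refl
... | no b≢u rewrite pos-tail v a≢u = refl
pos-swapAdj (a ∷ b ∷ v) (_ ∷ v!) {suc k} (s≤s 1+k<m) u with a Fin.≟ u
... | yes _ = refl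
... | no _  = cong suc (pos-swapAdj (b ∷ v) v! 1+k<m u)

module _ {n : ℕ} {v : Ordering n} (v! : IsOrdering v) where
  open DecMembership (Fin._≟_ {n}) using (_∈?_)

  -- Pigeonhole: a missing `u` could be prepended, giving `suc n` distinct elements of `Fin n`.
  ordering-complete : ∀ u → u ∈ toList v
  ordering-complete u = decidable-stable (u ∈? toList v) λ u∉v →
    <-irrefl refl (begin-strict
      n                        ≡⟨ length-toList v ⟨
      length (toList v)        <⟨ length-≤-injection _≡_ (All.tabulate (λ w∈v u≡w → u∉v (subst (_∈ toList v) (sym u≡w) w∈v)) ∷ v!)
                                    (λ {w} _ → w , ∈-allFin w , refl) (λ _ _ p q → trans p (sym q)) ⟩
      length (allFin n)        ≡⟨ length-tabulate {n = n} (λ i → i) ⟩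
      n                        ∎)
    where open ≤-Reasoning

  pos<n : ∀ u → pos v u < n
  pos<n u = ∈⇒pos< v (ordering-complete u)

  lookup-pos : ∀ u → lookup v (fromℕ< (pos<n u)) ≡ u
  lookup-pos u = pos⇒lookup v _ (sym (Fin.toℕ-fromℕ< (pos<n u)))

  pos-injective : ∀ {u w} → pos v u ≡ pos v w → u ≡ w
  pos-injective {u} {w} eq = trans (sym (lookup-pos u)) (trans (cong (lookup v) (Fin.fromℕ<-cong _ _ eq _ _)) (lookup-pos w))

  pos-surjective : ∀ {t} → t < n → ∃[ u ] pos v u ≡ t
  pos-surjective t<n = lookup v (fromℕ< t<n) , trans (pos-lookup v v! _) (Fin.toℕ-fromℕ< t<n)

  pos-determines : ∀ {w : Ordering n} → pos v ≗ pos w → v ≡ w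
  pos-determines {w} eq = trans (sym (tabulate∘lookup v)) (trans
    (tabulate-cong λ i → sym (pos⇒lookup w i (trans (sym (eq (lookup v i))) (pos-lookup v v! i))))
    (tabulate∘lookup w))

-- Orderings as ranked families, read from either end

positions : SetOfOrderings n → RankedFamily n
positions Ω = record
  { Carrier         = Ordering _
  ; members         = orders Ω
  ; members!        = distinct Ω
  ; rank            = pos
  ; rank<n          = λ v∈ → pos<n (allOrd Ω _ v∈)
  ; rank-injective  = λ v∈ → pos-injective (allOrd Ω _ v∈)
  ; rank-surjective = λ v∈ → pos-surjective (allOrd Ω _ v∈)
  ; rank-determines = λ v∈ w∈ → pos-determines (allOrd Ω _ v∈)
  }

-- Among `suc n` positions the last is `n`, so `n ∸ t` is position `t` counted from the end. All
-- ranks are at most `n`, which makes this reversal injective.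
reverseRanks : RankedFamily (suc n) → RankedFamily (suc n)
reverseRanks {n} Φ = record
  { Carrier         = Carrier
  ; members         = members
  ; members!        = members!
  ; rank            = λ v u → n ∸ rank v u
  ; rank<n          = λ {v} v∈ u → s≤s (m∸n≤m n (rank v u))
  ; rank-injective  = λ v∈ eq → rank-injective v∈ (cancel v∈ v∈ eq)
  ; rank-surjective = λ v∈ {t} t<1+n → let u , eq = rank-surjective v∈ (s≤s (m∸n≤m n t)) in
                        u , trans (cong (n ∸_) eq) (m∸[m∸n]≡n (s≤s⁻¹ t<1+n))
  ; rank-determines = λ v∈ w∈ eq → rank-determines v∈ w∈ (λ u → cancel v∈ w∈ (eq u))
  }
  where
  open RankedFamily Φ
  cancel : ∀ {v w a b} → v ∈ members → w ∈ members → n ∸ rank v a ≡ n ∸ rank w b → rank v a ≡ rank w b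
  cancel v∈ w∈ = ∸-cancelˡ-≡ (s≤s⁻¹ (rank<n v∈ _)) (s≤s⁻¹ (rank<n w∈ _))

before-reverseRanks : (Φ : RankedFamily (suc n)) → ∀ x y →
  RankedFamily.before (reverseRanks Φ) x y ≡ RankedFamily.before Φ y x
before-reverseRanks {n} Φ x y = ∑-cong members λ {v} v∈ → ≤-antisym
  (𝟙-mono (n ∸ rank v x <? n ∸ rank v y) (rank v y <? rank v x) (λ p → ≰⇒> λ x≤y → <⇒≱ p (∸-monoʳ-≤ n x≤y)))
  (𝟙-mono (rank v y <? rank v x) (n ∸ rank v x <? n ∸ rank v y) (λ p → ∸-monoʳ-< p (s≤s⁻¹ (rank<n v∈ x))))
  where open RankedFamily Φ

initial⇒shiftable : (Ω : SetOfOrderings n) → ∀ {x} → Initial Ω x → RankedFamily.Shiftable (positions Ω) x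
initial⇒shiftable Ω {x} init {v} v∈ {k} x-at = swapAdj v k , init v v∈ k x-at ,
  pos-swapAdj v (allOrd Ω v v∈) (subst (_< _) x-at (pos<n (allOrd Ω v v∈) x))

-- Swapping `y` with its successor is, seen from the end, moving `y` one place forward; `swapℕ-∸`
-- translates the swap.
final⇒shiftable : (Ω : SetOfOrderings (suc n)) → ∀ {y} → Final Ω y →
  RankedFamily.Shiftable (reverseRanks (positions Ω)) y
final⇒shiftable {n} Ω {y} final {v} v∈ {k} y-at = swapAdj v (pos v y) , final v v∈ _ refl (s≤s y<n) , shifted
  where
  v! : IsOrdering v
  v! = allOrd Ω v v∈
  y<n : pos v y < n
  -- The reversed rank of `y` is a successor, so `y` is not last and has a successor to be swapped
  -- with.
  y<n = ≰⇒> λ n≤y → 0≢1+n (trans (sym (m≤n⇒m∸n≡0 n≤y)) y-at)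
  k≡ : k ≡ n ∸ suc (pos v y)
  k≡ = suc-injective (trans (sym y-at) (+-∸-assoc 1 y<n))
  shifted : ∀ u → n ∸ pos (swapAdj v (pos v y)) u ≡ swapℕ k (n ∸ pos v u)
  shifted u rewrite k≡ = trans (cong (n ∸_) (pos-swapAdj v v! (s≤s y<n) u))
    (sym (swapℕ-∸ n (pos v y) (pos v u) y<n (s≤s⁻¹ (pos<n v! u))))

-- From a subset of at least half the elements to a middle pair

elements : Subset n → List (Fin n)
elements []            = []
elements (inside ∷ p)  = zero ∷ map suc (elements p)
elements (outside ∷ p) = map suc (elements p)

length-elements : (p : Subset n) → length (elements p) ≡ ∣ p ∣
length-elements []            = refl
length-elements (inside ∷ p)  = cong suc (trans (length-map suc (elements p)) (length-elements p))
length-elements (outside ∷ p) = trans (length-map suc (elements p)) (length-elements p)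

elements-unique : (p : Subset n) → Unique (elements p)
elements-unique []            = []
elements-unique (inside ∷ p)  = All.tabulate zero≢ ∷ Unique.map⁺ Fin.suc-injective (elements-unique p)
  where
  zero≢ : ∀ {u} → u ∈ map suc (elements p) → zero ≢ u
  zero≢ u∈ refl with ∈-map⁻ suc u∈
  ... | _ , _ , ()
elements-unique (outside ∷ p) = Unique.map⁺ Fin.suc-injective (elements-unique p)

∈-elements⁻ : (p : Subset n) {u : Fin n} → u ∈ elements p → u ∈ˢ p
∈-elements⁻ (inside ∷ p) (here refl) = here
∈-elements⁻ (inside ∷ p) (there u∈) with ∈-map⁻ suc u∈
... | _ , w∈ , refl = there (∈-elements⁻ p w∈)
∈-elements⁻ (outside ∷ p) u∈ with ∈-map⁻ suc u∈
... | _ , w∈ , refl = there (∈-elements⁻ p w∈)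

half-shiftable⇒middlePair : 7 ≤ n → (Φ : RankedFamily n) (p : Subset n) →
  (∀ x → x ∈ˢ p → RankedFamily.Shiftable Φ x) → n ≤ 2 * ∣ p ∣ →
  ∃[ x ] ∃[ y ] (x ≢ y × RankedFamily.MiddlePair Φ x y)
half-shiftable⇒middlePair {n} 7≤n Φ p shiftable half =
  middlePair-exists Φ (elements p) (elements-unique p)
    (All.tabulate (λ {u} u∈ → shiftable u (∈-elements⁻ p u∈)))
    -- Here `2 * 2 < n` and `n` is at most twice the length, so the list has at least three
    -- elements.
    (*-cancelˡ-< 2 2 _ (<-≤-trans (≤-trans (m≤m+n 5 2) 7≤n) half′)) half′
  where
  half′ : n ≤ 2 * length (elements p)
  half′ = subst (λ l → n ≤ 2 * l) (sym (length-elements p)) half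

before≡countBefore : (Ω : SetOfOrderings n) → ∀ x y →
  RankedFamily.before (positions Ω) x y ≡ countBefore Ω x y
before≡countBefore Ω x y = ∑-𝟙 (λ v → pos v x <? pos v y) (orders Ω)

theorem3 : (n : ℕ) → 7 ≤ n → (Ω : SetOfOrderings n) →
    AtLeastHalf Ω (Initial Ω) ⊎ AtLeastHalf Ω (Final Ω) → Balanced Ω
theorem3 n 7≤n Ω (inj₁ (p , initial , half))
  with half-shiftable⇒middlePair 7≤n (positions Ω) p (λ x x∈p → initial⇒shiftable Ω (initial x x∈p)) half
... | x , y , x≢y , middle = inj₁ (x , y , x≢y ,
  subst (λ c → length (orders Ω) ≤ 3 * c × 3 * c ≤ 2 * length (orders Ω)) (before≡countBefore Ω x y) middle)
-- The bound `7 ≤ n` rules out zero, giving the shape that `reverseRanks` expects.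
theorem3 (suc n) 7≤n Ω (inj₂ (p , final , half))
  with half-shiftable⇒middlePair 7≤n (reverseRanks (positions Ω)) p (λ y y∈p → final⇒shiftable Ω (final y y∈p)) half
-- The pair is returned in the opposite order because reversal exchanges `x` before `y` with `y`
-- before `x`.
... | x , y , x≢y , middle = inj₁ (y , x , x≢y ∘ sym ,
  subst (λ c → length (orders Ω) ≤ 3 * c × 3 * c ≤ 2 * length (orders Ω))
    (trans (before-reverseRanks (positions Ω) x y) (before≡countBefore Ω y x)) middle)
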